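{- Let $t$ be a positive integer. (a) Assume that $7t(3t-1)$ is neither of the form $l(3l-1)$ nor of the form $l(3l+1)$ for any $l\in\mathbb{N}$. Then the interval $[56t-29,\,14t(3t-1)-1]$ contains an integer $n\equiv 3\pmod 4$ with $a_7^+(n)$ odd. (b) Assume that $14t(6t-1)$ is neither of the form $l(3l-1)$ nor of the form $l(3l+1)$ for any $l\in\mathbb{N}$. Then the interval $[112t-29,\,28t(6t-1)-1]$ contains an integer $n\equiv 3\pmod 4$ with $a_7^+(n)$ even. In particular, $c_7^+(n)$ takes both even and odd values infinitely often for $n$ in the arithmetic progression $n\equiv 3\pmod 4$.
   Context: Let $q=e^{2\pi i z}$ with $z$ in the upper half-plane, and $\eta(z)=q^{1/24}\prod_{n\ge1}(1-q^n)$. Define $f_7^+(z)=\left(\frac{\eta(z)}{\eta(7z)}\right)^{4}=\sum_{n\ge -1}a_7^+(n)q^n$ (so $a_7^+(n)=0$ for $n<-1$). Define $j_7^+(z)=\left(\frac{\eta(z)}{\eta(7z)}\right)^{4}+4+7^2\left(\frac{\eta(7z)}{\eta(z)}\right)^{4}$ and let $c_7^+(n)$ be the coefficient of $q^n$ in its $q$-expansion. -}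

module Defs where

open import Data.Nat as ℕ using (ℕ; zero; suc; _%_; _≡ᵇ_)
open import Data.Integer as ℤ using (ℤ; +_; -[1+_]; _+_; _*_; -_)
open import Data.Bool using (if_then_else_)

Series : Set
Series = ℕ → ℤ

sumUpTo : ℕ → (ℕ → ℤ) → ℤ
sumUpTo zero    f = f 0
sumUpTo (suc m) f = sumUpTo m f + f (suc m)

_⊛_ : Series → Series → Series
(f ⊛ g) m = sumUpTo m (λ i → f i * g (m ℕ.∸ i))

one : Series
one zero    = + 1
one (suc _) = + 0

pow : Series → ℕ → Series
pow f zero    = one
pow f (suc k) = f ⊛ pow f k

-- the polynomial 1 - q^d   (d ≥ 1)
oneMinusQ : ℕ → Series
oneMinusQ d m = if m ≡ᵇ 0 then + 1 else (if m ≡ᵇ d then - (+ 1) else + 0)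

-- the power series 1/(1 - q^d) = Σ_k q^{dk}   (d ≥ 1)
geomQ : ℕ → Series
geomQ d m = if (m % suc (d ℕ.∸ 1)) ≡ᵇ 0 then + 1 else + 0

factorF : ℕ → Series
factorF k = pow (oneMinusQ k) 4 ⊛ pow (geomQ (7 ℕ.* k)) 4

factorG : ℕ → Series
factorG k = pow (oneMinusQ (7 ℕ.* k)) 4 ⊛ pow (geomQ k) 4

prodTo : (ℕ → Series) → ℕ → Series
prodTo fac zero    = one
prodTo fac (suc N) = prodTo fac N ⊛ fac (suc N)

-- coefficient of q^m in the infinite product ∏_{k≥1} fac k; factors with k > m
-- are ≡ 1 mod q^{m+1}, so the truncation at N = m gives the exact coefficient.
infProdCoeff : (ℕ → Series) → ℕ → ℤ
infProdCoeff fac m = prodTo fac m m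

-- (η(z)/η(7z))^4 = q^{-1} ∏ (1-q^n)^4/(1-q^{7n})^4 = Σ_{n ≥ -1} a₇⁺(n) q^n
a7⁺ : ℤ → ℤ
a7⁺ -[1+ zero ]  = infProdCoeff factorF 0
a7⁺ -[1+ suc _ ] = + 0
a7⁺ (+ n)        = infProdCoeff factorF (suc n)

-- coefficient of q^n in (η(7z)/η(z))^4 = q ∏ (1-q^{7n})^4/(1-q^n)^4
b7⁺ : ℤ → ℤ
b7⁺ -[1+ _ ]    = + 0
b7⁺ (+ zero)    = + 0
b7⁺ (+ suc n)   = infProdCoeff factorG n

four : ℤ → ℤ
four (+ zero) = + 4
four _        = + 0

-- j₇⁺ = (η(z)/η(7z))^4 + 4 + 7^2 (η(7z)/η(z))^4 = Σ c₇⁺(n) q^n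
c7⁺ : ℤ → ℤ
c7⁺ n = a7⁺ n + four n + + 49 * b7⁺ n

{-# OPTIONS --safe #-}
module Submission where

-- Modulo 2, (1 − q^k)^4 = 1 + q^{4k}, so a₇⁺(4 m − 1) is congruent to the coefficient
-- h(m) of ∏ (1 + q^k) / (1 + q^{7k}).  Euler's pentagonal number theorem modulo 2,
-- applied to both products, gives Σ_p h(m − 7 p) ≡ [m is pentagonal], the sum being
-- over the generalised pentagonal numbers p ≤ m / 7.
-- (a) Let p_t = t (3 t − 1) / 2.  If m = 7 p_t is not pentagonal, the term h(0) = 1
-- must be cancelled by another odd term h(7 (p_t − p)), and p_t − p ≥ 2 t − 1.
-- (b) No pentagonal number is 3 modulo 7, so h(7 x + 3) is always even.
-- The coefficients b₇⁺(n) are even unless n ≡ 1 mod 4, which transfers both to c₇⁺.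

open import Defs
open import Algebra.Properties.Ring using (x[y-z]≈xy-xz; [y-z]x≈yx-zx)
open import Algebra.Solver.Ring.AlmostCommutativeRing using (fromCommutativeRing)
import Algebra.Solver.Ring.Simple as RingSolver
open import Data.Bool using (if_then_else_)
open import Data.Nat using (ℕ; zero; suc; _+_; _*_; _∸_; _≤_; _<_; _%_; _/_; _≡ᵇ_; z≤n; s≤s; parity; NonZero)
import Data.Nat.Divisibility as ℕ
open import Data.Nat.DivMod using ([m+n]%n≡m%n; m<n⇒m%n≡m; [m+kn]%n≡m%n; m%n<n; m≡m%n+[m/n]*n)
import Data.Nat.Properties as ℕ
open import Data.Nat.Tactic.RingSolver using (solve-∀)
open import Data.Integer as ℤ using (ℤ; +_; -[1+_]; ∣_∣)
open import Data.Integer.Divisibility using (_∣_)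
import Data.Integer.Properties as ℤ
import Data.Integer.Tactic.RingSolver as ℤ-Solver
open import Data.Parity.Base as ℙ using (Parity; 0ℙ; 1ℙ)
import Data.Parity.Properties as ℙ
open import Data.Product using (_×_; _,_; proj₁; proj₂; ∃-syntax)
open import Function using (_∘_)
open import Relation.Binary.PropositionalEquality
open import Relation.Nullary using (¬_; yes; no; ¬?; from-yes; contradiction)

module ℙ-Solver = RingSolver (fromCommutativeRing ℙ.+-*-commutativeRing) ℙ._≟_

-- Shifts of coefficient sequences.

private variable
  A B : Set

-- Multiplication by q^d. The filler `z` is a parameter, so the same function serves over the
-- integers and modulo 2 and `shift-map` can pass between them.
shift : A → ℕ → (ℕ → A) → ℕ → A
shift z zero    f m       = f m
shift z (suc d) f zero    = z
shift z (suc d) f (suc m) = shift z d f m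

shift-cong : ∀ {z : A} d {f g} → f ≗ g → shift z d f ≗ shift z d g
shift-cong zero    f≗g m       = f≗g m
shift-cong (suc d) f≗g zero    = refl
shift-cong (suc d) f≗g (suc m) = shift-cong d f≗g m

shift-map : ∀ (h : A → B) {z} d f → h ∘ shift z d f ≗ shift (h z) d (h ∘ f)
shift-map h zero    f m       = refl
shift-map h (suc d) f zero    = refl
shift-map h (suc d) f (suc m) = shift-map h d f m

shift-< : ∀ (z : A) {d} f {m} → m < d → shift z d f m ≡ z
shift-< z f {zero}  (s≤s m≤d) = refl
shift-< z f {suc m} (s≤s m<d) = shift-< z f m<d

-- With `e = 0` this reads off the coefficients of q^d f, hence the rewriting of `d` as `d + 0` at
-- its uses; a general `e` strips one block from a longer shift.
shift-+ : ∀ (z : A) d e f m → shift z (d + e) f (d + m) ≡ shift z e f m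
shift-+ z zero    e f m = refl
shift-+ z (suc d) e f m = shift-+ z d e f m

shift-shift : ∀ (z : A) d e f → shift z d (shift z e f) ≗ shift z (d + e) f
shift-shift z zero    e f m       = refl
shift-shift z (suc d) e f zero    = refl
shift-shift z (suc d) e f (suc m) = shift-shift z d e f m

-- Finite sums and the Cauchy product.

sum-cong : ∀ m {f g : ℕ → ℤ} → (∀ i → i ≤ m → f i ≡ g i) → sumUpTo m f ≡ sumUpTo m g
sum-cong zero    eq = eq 0 z≤n
sum-cong (suc m) eq = cong₂ ℤ._+_ (sum-cong m λ i i≤m → eq i (ℕ.m≤n⇒m≤1+n i≤m)) (eq (suc m) ℕ.≤-refl)

sum-0 : ∀ m → sumUpTo m (λ _ → + 0) ≡ + 0
sum-0 zero    = refl
sum-0 (suc m) = cong (ℤ._+ + 0) (sum-0 m)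

sum-head : ∀ m (f : ℕ → ℤ) → sumUpTo (suc m) f ≡ f 0 ℤ.+ sumUpTo m (f ∘ suc)
sum-head zero    f = refl
sum-head (suc m) f = trans (cong (ℤ._+ f (suc (suc m))) (sum-head m f))
                           (ℤ.+-assoc (f 0) _ _)

sum-minus : ∀ m (f g : ℕ → ℤ) → sumUpTo m (λ i → f i ℤ.- g i) ≡ sumUpTo m f ℤ.- sumUpTo m g
sum-minus zero    f g = refl
sum-minus (suc m) f g = trans (cong (ℤ._+ (f (suc m) ℤ.- g (suc m))) (sum-minus m f g))
                              (rearrange (sumUpTo m f) (sumUpTo m g) _ _)
  where
  rearrange : ∀ a b c d → (a ℤ.- b) ℤ.+ (c ℤ.- d) ≡ (a ℤ.+ c) ℤ.- (b ℤ.+ d)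
  rearrange = ℤ-Solver.solve-∀

⊛-congˡ : ∀ f {g g′} → g ≗ g′ → f ⊛ g ≗ f ⊛ g′
⊛-congˡ f g≗g′ m = sum-cong m λ i _ → cong (f i ℤ.*_) (g≗g′ (m ∸ i))

⊛-congʳ : ∀ {f f′} g → f ≗ f′ → f ⊛ g ≗ f′ ⊛ g
⊛-congʳ g f≗f′ m = sum-cong m λ i _ → cong (ℤ._* g (m ∸ i)) (f≗f′ i)

⊛-identityˡ : ∀ g → one ⊛ g ≗ g
⊛-identityˡ g zero    = ℤ.*-identityˡ (g 0)
⊛-identityˡ g (suc m) = trans (sum-head m _)
  (trans (cong₂ ℤ._+_ (ℤ.*-identityˡ (g (suc m))) (trans (sum-cong m λ i _ → ℤ.*-zeroˡ (g (m ∸ i))) (sum-0 m)))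
         (ℤ.+-identityʳ _))

one-∸ : ∀ {i m} → i ≤ m → one (suc m ∸ i) ≡ + 0
one-∸ {i} {m} i≤m rewrite ℕ.+-∸-assoc 1 i≤m = refl

⊛-identityʳ : ∀ f → f ⊛ one ≗ f
⊛-identityʳ f zero    = ℤ.*-identityʳ (f 0)
⊛-identityʳ f (suc m) = trans
  (cong₂ ℤ._+_ (trans (sum-cong m λ i i≤m → trans (cong (f i ℤ.*_) (one-∸ i≤m)) (ℤ.*-zeroʳ (f i))) (sum-0 m))
               (trans (cong (λ k → f (suc m) ℤ.* one k) (ℕ.n∸n≡0 m)) (ℤ.*-identityʳ (f (suc m)))))
  (ℤ.+-identityˡ _)

shiftℤ : ℕ → Series → Series
shiftℤ = shift (+ 0)

shift-⊛ˡ : ∀ d f g → shiftℤ d f ⊛ g ≗ shiftℤ d (f ⊛ g)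
shift-⊛ˡ zero    f g m       = refl
shift-⊛ˡ (suc d) f g zero    = ℤ.*-zeroˡ (g 0)
shift-⊛ˡ (suc d) f g (suc m) = trans (sum-head m _)
  (trans (cong₂ ℤ._+_ (ℤ.*-zeroˡ (g (suc m))) (shift-⊛ˡ d f g m)) (ℤ.+-identityˡ _))

shift-⊛ʳ : ∀ d f g → f ⊛ shiftℤ d g ≗ shiftℤ d (f ⊛ g)
shift-⊛ʳ zero    f g m       = refl
shift-⊛ʳ (suc d) f g zero    = ℤ.*-zeroʳ (f 0)
shift-⊛ʳ (suc d) f g (suc m) = trans
  -- For `i ≤ m` the truncated difference `suc m ∸ i` is a successor; the last term, at `suc m`,
  -- meets the zero constant coefficient of the shifted series.
  (cong₂ ℤ._+_ (sum-cong m λ i i≤m → cong (λ k → f i ℤ.* shiftℤ (suc d) g k) (ℕ.+-∸-assoc 1 i≤m))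
               (trans (cong (λ k → f (suc m) ℤ.* shiftℤ (suc d) g k) (ℕ.n∸n≡0 m)) (ℤ.*-zeroʳ (f (suc m)))))
  (trans (ℤ.+-identityʳ _) (shift-⊛ʳ d f g m))

-- Factors 1 - q^d and their inverses.

-- Multiplication by 1 − q^d.
Δ : ℕ → Series → Series
Δ d f m = f m ℤ.- shiftℤ d f m

Δ-cong : ∀ d {f g} → f ≗ g → Δ d f ≗ Δ d g
Δ-cong d f≗g m = cong₂ ℤ._-_ (f≗g m) (shift-cong d f≗g m)

Δ-⊛ˡ : ∀ d f g → Δ d f ⊛ g ≗ Δ d (f ⊛ g)
Δ-⊛ˡ d f g m = trans
  (sum-cong m λ i _ → [y-z]x≈yx-zx ℤ.+-*-ring (g (m ∸ i)) (f i) (shiftℤ d f i))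
  (trans (sum-minus m _ _) (cong (ℤ._-_ ((f ⊛ g) m)) (shift-⊛ˡ d f g m)))

Δ-⊛ʳ : ∀ d f g → f ⊛ Δ d g ≗ Δ d (f ⊛ g)
Δ-⊛ʳ d f g m = trans
  (sum-cong m λ i _ → x[y-z]≈xy-xz ℤ.+-*-ring (f i) (g (m ∸ i)) (shiftℤ d g (m ∸ i)))
  (trans (sum-minus m _ _) (cong (ℤ._-_ ((f ⊛ g) m)) (shift-⊛ʳ d f g m)))

-- The new factor is applied innermost, so that in `Δ^-pow-geomQ` it meets one factor of the power
-- of `geomQ` directly and cancels it.
Δ^ : ℕ → ℕ → Series → Series
Δ^ d zero    f = f
Δ^ d (suc k) f = Δ^ d k (Δ d f)

Δ^-Δ : ∀ d k f → Δ^ d k (Δ d f) ≡ Δ d (Δ^ d k f)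
Δ^-Δ d zero    f = refl
Δ^-Δ d (suc k) f = Δ^-Δ d k (Δ d f)

Δ^-cong : ∀ d k {f g} → f ≗ g → Δ^ d k f ≗ Δ^ d k g
Δ^-cong d zero    f≗g = f≗g
Δ^-cong d (suc k) f≗g = Δ^-cong d k (Δ-cong d f≗g)

Δ^-⊛ˡ : ∀ d k f g → Δ^ d k f ⊛ g ≗ Δ^ d k (f ⊛ g)
Δ^-⊛ˡ d zero    f g m = refl
Δ^-⊛ˡ d (suc k) f g m = trans (Δ^-⊛ˡ d k (Δ d f) g m) (Δ^-cong d k (Δ-⊛ˡ d f g) m)

Δ^-⊛ʳ : ∀ d k f g → f ⊛ Δ^ d k g ≗ Δ^ d k (f ⊛ g)
Δ^-⊛ʳ d zero    f g m = refl
Δ^-⊛ʳ d (suc k) f g m = trans (Δ^-⊛ʳ d k f (Δ d g) m) (Δ^-cong d k (Δ-⊛ʳ d f g) m)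

oneMinusQ-Δ : ∀ d → oneMinusQ (suc d) ≗ Δ (suc d) one
oneMinusQ-Δ d zero    = refl
oneMinusQ-Δ d (suc m) = trans (indicator m d) (sym (ℤ.+-identityˡ _))
  where
  indicator : ∀ m d → (if m ≡ᵇ d then ℤ.- (+ 1) else + 0) ≡ ℤ.- shiftℤ d one m
  indicator zero    zero    = refl
  indicator zero    (suc d) = refl
  indicator (suc m) zero    = refl
  indicator (suc m) (suc d) = indicator m d

-- From index d + 1 on, the coefficients are periodic with period d + 1 and the difference cancels;
-- below that only the constant term is nonzero.
Δ-geomQ : ∀ d → Δ (suc d) (geomQ (suc d)) ≗ one
Δ-geomQ d m with suc d ℕ.≤? m
Δ-geomQ d m | yes d≤m with x , refl ← ℕ.m≤n⇒∃[o]m+o≡n d≤m = begin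
  geomQ (suc d) (suc d + x) ℤ.- shiftℤ (suc d) (geomQ (suc d)) (suc d + x)
    ≡⟨ cong₂ ℤ._-_ (cong (λ r → if r ≡ᵇ 0 then + 1 else + 0)
                         (trans (cong (_% suc d) (ℕ.+-comm (suc d) x)) ([m+n]%n≡m%n x (suc d))))
                   (trans (cong (λ e → shiftℤ e (geomQ (suc d)) (suc d + x)) (sym (ℕ.+-identityʳ (suc d))))
                          (shift-+ (+ 0) (suc d) 0 (geomQ (suc d)) x)) ⟩
  geomQ (suc d) x ℤ.- geomQ (suc d) x ≡⟨ ℤ.+-inverseʳ (geomQ (suc d) x) ⟩
  + 0 ∎
  where open ≡-Reasoning
Δ-geomQ d m | no d≰m = trans
  (cong₂ ℤ._-_ (cong (λ r → if r ≡ᵇ 0 then + 1 else + 0) (m<n⇒m%n≡m (ℕ.≰⇒> d≰m)))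
               (shift-< (+ 0) (geomQ (suc d)) (ℕ.≰⇒> d≰m)))
  (indicator m)
  where
  indicator : ∀ m → (if m ≡ᵇ 0 then + 1 else + 0) ℤ.- + 0 ≡ one m
  indicator zero    = refl
  indicator (suc m) = refl

pow-oneMinusQ : ∀ d k → pow (oneMinusQ (suc d)) k ≗ Δ^ (suc d) k one
pow-oneMinusQ d zero    m = refl
pow-oneMinusQ d (suc k) m = begin
  (oneMinusQ (suc d) ⊛ pow (oneMinusQ (suc d)) k) m ≡⟨ ⊛-congʳ (pow (oneMinusQ (suc d)) k) (oneMinusQ-Δ d) m ⟩
  (Δ (suc d) one ⊛ pow (oneMinusQ (suc d)) k) m     ≡⟨ ⊛-congˡ (Δ (suc d) one) (pow-oneMinusQ d k) m ⟩
  (Δ (suc d) one ⊛ Δ^ (suc d) k one) m              ≡⟨ Δ-⊛ˡ (suc d) one (Δ^ (suc d) k one) m ⟩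
  Δ (suc d) (one ⊛ Δ^ (suc d) k one) m              ≡⟨ Δ-cong (suc d) (⊛-identityˡ (Δ^ (suc d) k one)) m ⟩
  Δ (suc d) (Δ^ (suc d) k one) m                    ≡⟨ cong (λ f → f m) (Δ^-Δ (suc d) k one) ⟨
  Δ^ (suc d) k (Δ (suc d) one) m                    ∎
  where open ≡-Reasoning

Δ^-pow-geomQ : ∀ d k → Δ^ (suc d) k (pow (geomQ (suc d)) k) ≗ one
Δ^-pow-geomQ d zero    m = refl
Δ^-pow-geomQ d (suc k) m = trans (Δ^-cong (suc d) k absorb m) (Δ^-pow-geomQ d k m)
  where
  p = pow (geomQ (suc d)) k
  absorb : Δ (suc d) (geomQ (suc d) ⊛ p) ≗ p
  absorb i = trans (sym (Δ-⊛ˡ (suc d) (geomQ (suc d)) p i))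
                   (trans (⊛-congʳ p (Δ-geomQ d) i) (⊛-identityˡ p i))

-- A factor (1 - q^{d+1})^k / (1 - q^{e+1})^k is handled by clearing its denominator, so no further
-- inverses of series are needed.
Δ^-quotient : ∀ f d e k →
  Δ^ (suc e) k (f ⊛ (pow (oneMinusQ (suc d)) k ⊛ pow (geomQ (suc e)) k)) ≗ Δ^ (suc d) k f
Δ^-quotient f d e k m = begin
  Δ^ (suc e) k (f ⊛ (u ⊛ v)) m             ≡⟨ Δ^-cong (suc e) k (⊛-congˡ f uv) m ⟩
  Δ^ (suc e) k (f ⊛ Δ^ (suc d) k v) m      ≡⟨ Δ^-cong (suc e) k (λ i → trans (Δ^-⊛ʳ (suc d) k f v i) (sym (Δ^-⊛ˡ (suc d) k f v i))) m ⟩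
  Δ^ (suc e) k (Δ^ (suc d) k f ⊛ v) m      ≡⟨ Δ^-⊛ʳ (suc e) k (Δ^ (suc d) k f) v m ⟨
  (Δ^ (suc d) k f ⊛ Δ^ (suc e) k v) m      ≡⟨ ⊛-congˡ (Δ^ (suc d) k f) (Δ^-pow-geomQ e k) m ⟩
  (Δ^ (suc d) k f ⊛ one) m                 ≡⟨ ⊛-identityʳ (Δ^ (suc d) k f) m ⟩
  Δ^ (suc d) k f m                         ∎
  where
  open ≡-Reasoning
  u = pow (oneMinusQ (suc d)) k
  v = pow (geomQ (suc e)) k
  uv : u ⊛ v ≗ Δ^ (suc d) k v
  uv i = trans (⊛-congʳ v (pow-oneMinusQ d k) i)
               (trans (Δ^-⊛ˡ (suc d) k one v i) (Δ^-cong (suc d) k (⊛-identityˡ v) i))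

-- Reduction modulo 2.

odd : ℤ → Parity
odd z = parity ∣ z ∣

odd-⊖ : ∀ m n → odd (m ℤ.⊖ n) ≡ parity m ℙ.+ parity n
odd-⊖ zero    zero    = refl
odd-⊖ zero    (suc n) = refl
odd-⊖ (suc m) zero    = sym (ℙ.+-identityʳ (parity (suc m)))
odd-⊖ (suc m) (suc n) = begin
  odd (suc m ℤ.⊖ suc n)                   ≡⟨ cong odd (ℤ.[1+m]⊖[1+n]≡m⊖n m n) ⟩
  odd (m ℤ.⊖ n)                           ≡⟨ odd-⊖ m n ⟩
  parity m ℙ.+ parity n                   ≡⟨ ℙ.+-homo-+ m n ⟨
  parity (suc (suc (m + n)))              ≡⟨ cong (parity ∘ suc) (ℕ.+-suc m n) ⟨
  parity (suc m + suc n)                  ≡⟨ ℙ.+-homo-+ (suc m) (suc n) ⟩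
  parity (suc m) ℙ.+ parity (suc n)       ∎
  where open ≡-Reasoning

odd-+ : ∀ i j → odd (i ℤ.+ j) ≡ odd i ℙ.+ odd j
odd-+ (+ m)    (+ n)    = ℙ.+-homo-+ m n
odd-+ (+ m)    -[1+ n ] = odd-⊖ m (suc n)
odd-+ -[1+ m ] (+ n)    = trans (odd-⊖ n (suc m)) (ℙ.+-comm (parity n) (parity (suc m)))
odd-+ -[1+ m ] -[1+ n ] = trans (cong (parity ∘ suc) (sym (ℕ.+-suc m n))) (ℙ.+-homo-+ (suc m) (suc n))

odd-minus : ∀ i j → odd (i ℤ.- j) ≡ odd i ℙ.+ odd j
odd-minus i j = trans (odd-+ i (ℤ.- j)) (cong (λ n → odd i ℙ.+ parity n) (ℤ.∣-i∣≡∣i∣ j))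

Series₂ : Set
Series₂ = ℕ → Parity

shift₂ : ℕ → Series₂ → Series₂
shift₂ = shift 0ℙ

-- The reduction modulo 2 of Δ, that is, multiplication by 1 + q^d.
∂ : ℕ → Series₂ → Series₂
∂ d f m = f m ℙ.+ shift₂ d f m

∂-cong : ∀ d {f g} → f ≗ g → ∂ d f ≗ ∂ d g
∂-cong d f≗g m = cong₂ ℙ._+_ (f≗g m) (shift-cong d f≗g m)

shift₂-distrib-+ : ∀ d (f g : Series₂) → shift₂ d (λ i → f i ℙ.+ g i) ≗ λ m → shift₂ d f m ℙ.+ shift₂ d g m
shift₂-distrib-+ zero    f g m       = refl
shift₂-distrib-+ (suc d) f g zero    = refl
shift₂-distrib-+ (suc d) f g (suc m) = shift₂-distrib-+ d f g m

shift₂-∂ : ∀ a d f m → shift₂ a (∂ d f) m ≡ shift₂ a f m ℙ.+ shift₂ (a + d) f m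
shift₂-∂ a d f m = trans (shift₂-distrib-+ a f (shift₂ d f) m)
                         (cong (shift₂ a f m ℙ.+_) (shift-shift 0ℙ a d f m))

∂-comm : ∀ a b f → ∂ a (∂ b f) ≗ ∂ b (∂ a f)
∂-comm a b f m = begin
  ∂ b f m ℙ.+ shift₂ a (∂ b f) m
    ≡⟨ cong (∂ b f m ℙ.+_) (shift₂-∂ a b f m) ⟩
  ∂ b f m ℙ.+ (shift₂ a f m ℙ.+ shift₂ (a + b) f m)
    ≡⟨ cong (λ c → ∂ b f m ℙ.+ (shift₂ a f m ℙ.+ shift₂ c f m)) (ℕ.+-comm a b) ⟩
  (f m ℙ.+ shift₂ b f m) ℙ.+ (shift₂ a f m ℙ.+ shift₂ (b + a) f m)
    ≡⟨ solve 4 (λ x y z w → (x :+ y) :+ (z :+ w) := (x :+ z) :+ (y :+ w)) refl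
         (f m) (shift₂ b f m) (shift₂ a f m) (shift₂ (b + a) f m) ⟩
  ∂ a f m ℙ.+ (shift₂ b f m ℙ.+ shift₂ (b + a) f m)
    ≡⟨ cong (∂ a f m ℙ.+_) (shift₂-∂ b a f m) ⟨
  ∂ a f m ℙ.+ shift₂ b (∂ a f) m ∎
  where
  open ≡-Reasoning
  open ℙ-Solver

-- Squaring is additive in characteristic 2: the two cross terms q^d cancel.
∂-square : ∀ d f → ∂ d (∂ d f) ≗ ∂ (d + d) f
∂-square d f m = trans
  (cong (∂ d f m ℙ.+_) (shift₂-∂ d d f m))
  (solve 3 (λ x y z → (x :+ y) :+ (y :+ z) := x :+ z) refl (f m) (shift₂ d f m) (shift₂ (d + d) f m))
  where open ℙ-Solver

odd-Δ : ∀ d f → odd ∘ Δ d f ≗ ∂ d (odd ∘ f)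
odd-Δ d f m = trans (odd-minus (f m) (shiftℤ d f m))
                    (cong (odd (f m) ℙ.+_) (shift-map odd d f m))

odd-Δ^4 : ∀ d f → odd ∘ Δ^ d 4 f ≗ ∂ (4 * d) (odd ∘ f)
odd-Δ^4 d f m = begin
  odd (Δ d (Δ d (Δ d (Δ d f))) m)          ≡⟨ two (Δ d (Δ d f)) m ⟩
  ∂ (d + d) (odd ∘ Δ d (Δ d f)) m          ≡⟨ ∂-cong (d + d) (two f) m ⟩
  ∂ (d + d) (∂ (d + d) (odd ∘ f)) m        ≡⟨ ∂-square (d + d) (odd ∘ f) m ⟩
  ∂ (d + d + (d + d)) (odd ∘ f) m          ≡⟨ cong (λ e → ∂ e (odd ∘ f) m) (quadruple d) ⟩
  ∂ (4 * d) (odd ∘ f) m                    ∎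
  where
  open ≡-Reasoning
  quadruple : ∀ d → d + d + (d + d) ≡ 4 * d
  quadruple = solve-∀
  two : ∀ g → odd ∘ Δ d (Δ d g) ≗ ∂ (d + d) (odd ∘ g)
  two g i = trans (odd-Δ d (Δ d g) i)
                  (trans (∂-cong d (odd-Δ d g) i) (∂-square d (odd ∘ g) i))

-- The factor 1 + q^{d+1} is invertible: the hypothesis gives f(i) = f(i - d - 1), or f(i) = 0 when
-- i ≤ d, and induction on the bound `M` finishes.
∂-vanish : ∀ d f M → (∀ i → i < M → ∂ (suc d) f i ≡ 0ℙ) → ∀ i → i < M → f i ≡ 0ℙ
∂-vanish d f (suc M) ∂f≡0 i (s≤s i≤M) = trans f≡shift shift≡0
  where
  f≡shift : f i ≡ shift₂ (suc d) f i
  f≡shift = ℙ.+-cancelʳ-≡ (shift₂ (suc d) f i) _ _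
    (trans (∂f≡0 i (s≤s i≤M)) (sym (ℙ.p+p≡0ℙ (shift₂ (suc d) f i))))
  shift≡0 : shift₂ (suc d) f i ≡ 0ℙ
  shift≡0 with suc d ℕ.≤? i
  ... | no  d≰i = shift-< 0ℙ f (ℕ.≰⇒> d≰i)
  ... | yes d≤i with x , refl ← ℕ.m≤n⇒∃[o]m+o≡n d≤i = begin
    shift₂ (suc d) f (suc d + x)       ≡⟨ cong (λ e → shift₂ e f (suc d + x)) (ℕ.+-identityʳ (suc d)) ⟨
    shift₂ (suc d + 0) f (suc d + x)   ≡⟨ shift-+ 0ℙ (suc d) 0 f x ⟩
    f x ≡⟨ ∂-vanish d f M (λ j j<M → ∂f≡0 j (ℕ.m<n⇒m<1+n j<M)) x (ℕ.≤-trans (s≤s (ℕ.m≤n+m x d)) i≤M) ⟩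
    0ℙ ∎
    where open ≡-Reasoning

-- Finite products of factors 1 + q^{dk}.

-- Multiplication by ∏_{s < k ≤ s + j} (1 + q^{dk}).
∏∂ : ℕ → ℕ → ℕ → Series₂ → Series₂
∏∂ d s zero    f = f
∏∂ d s (suc j) f = ∂ (d * (s + suc j)) (∏∂ d s j f)

∏∂-cong : ∀ d s j {f g} → f ≗ g → ∏∂ d s j f ≗ ∏∂ d s j g
∏∂-cong d s zero    f≗g = f≗g
∏∂-cong d s (suc j) f≗g = ∂-cong (d * (s + suc j)) (∏∂-cong d s j f≗g)

∂-∏∂ : ∀ e d s j f → ∂ e (∏∂ d s j f) ≗ ∏∂ d s j (∂ e f)
∂-∏∂ e d s zero    f m = refl
∂-∏∂ e d s (suc j) f m = trans (∂-comm e (d * (s + suc j)) (∏∂ d s j f) m)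
                               (∂-cong (d * (s + suc j)) (∂-∏∂ e d s j f) m)

-- The definition splits off the last factor; the telescoping of Shanks' sum also needs the first
-- one.
∏∂-first : ∀ d s j f → ∏∂ d s (suc j) f ≗ ∂ (d * suc s) (∏∂ d (suc s) j f)
∏∂-first d s zero    f m = cong (λ k → ∂ (d * k) f m) (ℕ.+-comm s 1)
∏∂-first d s (suc j) f m = begin
  ∂ (d * (s + suc (suc j))) (∏∂ d s (suc j) f) m
    ≡⟨ ∂-cong (d * (s + suc (suc j))) (∏∂-first d s j f) m ⟩
  ∂ (d * (s + suc (suc j))) (∂ (d * suc s) (∏∂ d (suc s) j f)) m
    ≡⟨ ∂-comm (d * (s + suc (suc j))) (d * suc s) (∏∂ d (suc s) j f) m ⟩
  ∂ (d * suc s) (∂ (d * (s + suc (suc j))) (∏∂ d (suc s) j f)) m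
    ≡⟨ cong (λ k → ∂ (d * suc s) (∂ (d * k) (∏∂ d (suc s) j f)) m) (ℕ.+-suc s (suc j)) ⟩
  ∂ (d * suc s) (∏∂ d (suc s) (suc j) f) m ∎
  where open ≡-Reasoning

∏∂-vanish : ∀ d s j f M → (∀ i → i < M → ∏∂ (suc d) s j f i ≡ 0ℙ) → ∀ i → i < M → f i ≡ 0ℙ
∏∂-vanish d s zero    f M eq = eq
∏∂-vanish d s (suc j) f M eq = ∏∂-vanish d s j f M (lemma (suc d * (s + suc j)) refl eq)
  where
  -- The exponent is generalised to a variable so that it can be matched as a successor, the form
  -- `∂-vanish` expects.
  lemma : ∀ e → e ≡ suc d * (s + suc j) →
          (∀ i → i < M → ∂ e (∏∂ (suc d) s j f) i ≡ 0ℙ) → ∀ i → i < M → ∏∂ (suc d) s j f i ≡ 0ℙ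
  lemma zero    eq with () ← trans eq (cong (suc d *_) (ℕ.+-suc s j))
  lemma (suc e) _ = ∂-vanish e (∏∂ (suc d) s j f) M

-- Coefficients in one residue class.

decimate : ℕ → ℕ → Series₂ → Series₂
decimate c r f x = f (c * x + r)

-- A shift by a multiple of c preserves residue classes modulo c. The bound `r < c` ensures that
-- index r itself lies below every nonzero such shift.
shift₂-decimate : ∀ {c r} → r < c → ∀ d f → decimate c r (shift₂ (c * d) f) ≗ shift₂ d (decimate c r f)
shift₂-decimate {c} {r} r<c zero f x = cong (λ e → shift₂ e f (c * x + r)) (ℕ.*-zeroʳ c)
shift₂-decimate {c} {r} r<c (suc d) f zero = shift-< 0ℙ f
  (subst (_< c * suc d) (sym (cong (_+ r) (ℕ.*-zeroʳ c))) (ℕ.<-≤-trans r<c (ℕ.m≤m*n c (suc d))))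
shift₂-decimate {c} {r} r<c (suc d) f (suc x) = begin
  shift₂ (c * suc d) f (c * suc x + r)     ≡⟨ cong₂ (λ e m → shift₂ e f m) (ℕ.*-suc c d) (trans (cong (_+ r) (ℕ.*-suc c x)) (ℕ.+-assoc c (c * x) r)) ⟩
  shift₂ (c + c * d) f (c + (c * x + r))   ≡⟨ shift-+ 0ℙ c (c * d) f (c * x + r) ⟩
  shift₂ (c * d) f (c * x + r)             ≡⟨ shift₂-decimate r<c d f x ⟩
  shift₂ d (decimate c r f) x              ∎
  where open ≡-Reasoning

∏∂-decimate : ∀ {c r} → r < c → ∀ d s j f → decimate c r (∏∂ (c * d) s j f) ≗ ∏∂ d s j (decimate c r f)
∏∂-decimate r<c d s zero f x = refl
∏∂-decimate {c} {r} r<c d s (suc j) f x = begin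
  ∂ (c * d * k) g (c * x + r)              ≡⟨ cong (λ e → ∂ e g (c * x + r)) (ℕ.*-assoc c d k) ⟩
  ∂ (c * (d * k)) g (c * x + r)            ≡⟨ cong (g (c * x + r) ℙ.+_) (shift₂-decimate r<c (d * k) g x) ⟩
  ∂ (d * k) (decimate c r g) x             ≡⟨ ∂-cong (d * k) (∏∂-decimate r<c d s j f) x ⟩
  ∂ (d * k) (∏∂ d s j (decimate c r f)) x  ∎
  where
  open ≡-Reasoning
  k = s + suc j
  g = ∏∂ (c * d) s j f

-- Shanks' identity and the pentagonal number theorem modulo 2.

tri : ℕ → ℕ
tri zero    = 0
tri (suc s) = tri s + suc s

-- The generalised pentagonal number s (3 s + 1) / 2, written as the exponent `s * n + tri s` of
-- Shanks' sum at `n = s`.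
pent⁺ : ℕ → ℕ
pent⁺ s = s * s + tri s

-- The generalised pentagonal number (s + 1)(3 (s + 1) − 1) / 2: the index is off by one.
pent⁻ : ℕ → ℕ
pent⁻ s = suc s * suc s + tri s

pentSum : ℕ → ℕ → Series₂ → Series₂
pentSum d zero    f m = f m
pentSum d (suc s) f m = pentSum d s f m ℙ.+ (shift₂ (d * pent⁻ s) f m ℙ.+ shift₂ (d * pent⁺ (suc s)) f m)

module _ (d : ℕ) (f : Series₂) (m : ℕ) where

  shanksTerm : ℕ → ℕ → ℕ → Parity
  shanksTerm n s j = shift₂ (d * (s * n + tri s)) (∏∂ d s j f) m

  -- The partial sum up to index s of Shanks' Σ_i (P_n / P_i) q^{i n + i (i + 1) / 2}, for n = s + j.
  shanksSum : ℕ → ℕ → ℕ → Parity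
  shanksSum n zero    j = shanksTerm n zero j
  shanksSum n (suc s) j = shanksSum n s (suc j) ℙ.+ shanksTerm n (suc s) j

  -- Induction on s. The new term for n + 1 splits along its last factor 1 + q^{d(n+1)}, the
  -- remainder from the induction along its first factor 1 + q^{d(s+1)}; modulo 2 everything cancels
  -- except one shifted product.
  shanks-telescope : ∀ n s j → n ≡ s + j →
    shanksSum (suc n) s (suc j) ℙ.+ shanksSum n s j ≡ shift₂ (d * (suc s * suc n + tri s)) (∏∂ d s j f) m
  shanks-telescope n zero j refl = begin
    shift₂ (d * 0) (∂ (d * suc n) g) m ℙ.+ shift₂ (d * 0) g m
      ≡⟨ cong (λ e → shift₂ e (∂ (d * suc n) g) m ℙ.+ shift₂ e g m) (ℕ.*-zeroʳ d) ⟩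
    (g m ℙ.+ shift₂ (d * suc n) g m) ℙ.+ g m
      ≡⟨ solve 2 (λ x y → (x :+ y) :+ x := y) refl (g m) (shift₂ (d * suc n) g m) ⟩
    shift₂ (d * suc n) g m
      ≡⟨ cong (λ e → shift₂ (d * e) g m) (expand n) ⟩
    shift₂ (d * (1 * suc n + 0)) g m ∎
    where
    open ≡-Reasoning
    open ℙ-Solver
    g = ∏∂ d 0 j f
    expand : ∀ n → suc n ≡ 1 * suc n + 0
    expand = solve-∀
  shanks-telescope n (suc s) j refl = begin
    (u ℙ.+ shift₂ (d * (suc s * suc n + tri (suc s))) (∂ (d * (suc s + suc j)) g) m)
      ℙ.+ (v ℙ.+ shift₂ (d * (suc s * n + tri (suc s))) g m)
      ≡⟨ cong₂ (λ x y → (u ℙ.+ x) ℙ.+ (v ℙ.+ y))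
           (trans (cong₂ (λ e k → shift₂ e (∂ (d * k) g) m) (e₁ d s n (tri s)) (ℕ.+-suc (suc s) j))
                  (shift₂-∂ (a + b) c g m))
           (cong (λ e → shift₂ e g m) (e₂ d s n (tri s))) ⟩
    (u ℙ.+ (shift₂ (a + b) g m ℙ.+ shift₂ (a + b + c) g m)) ℙ.+ (v ℙ.+ shift₂ a g m)
      ≡⟨ solve 5 (λ u v x y z → (u :+ (y :+ z)) :+ (v :+ x) := (u :+ v) :+ ((x :+ y) :+ z)) refl
           u v (shift₂ a g m) (shift₂ (a + b) g m) (shift₂ (a + b + c) g m) ⟩
    (u ℙ.+ v) ℙ.+ ((shift₂ a g m ℙ.+ shift₂ (a + b) g m) ℙ.+ shift₂ (a + b + c) g m)
      ≡⟨ cong (ℙ._+ ((shift₂ a g m ℙ.+ shift₂ (a + b) g m) ℙ.+ shift₂ (a + b + c) g m))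
           (trans (shanks-telescope n s (suc j) (sym (ℕ.+-suc s j)))
                  (trans (shift-cong a (∏∂-first d s j f) m) (shift₂-∂ a b g m))) ⟩
    (shift₂ a g m ℙ.+ shift₂ (a + b) g m) ℙ.+ ((shift₂ a g m ℙ.+ shift₂ (a + b) g m) ℙ.+ shift₂ (a + b + c) g m)
      ≡⟨ solve 2 (λ x y → x :+ (x :+ y) := y) refl (shift₂ a g m ℙ.+ shift₂ (a + b) g m) (shift₂ (a + b + c) g m) ⟩
    shift₂ (a + b + c) g m
      ≡⟨ cong (λ e → shift₂ e g m) (e₃ d s n (tri s)) ⟩
    shift₂ (d * (suc (suc s) * suc n + tri (suc s))) g m ∎
    where
    open ≡-Reasoning
    open ℙ-Solver
    u = shanksSum (suc n) s (suc (suc j))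
    v = shanksSum n s (suc j)
    g = ∏∂ d (suc s) j f
    a = d * (suc s * suc n + tri s)
    b = d * suc s
    c = d * suc n
    e₁ : ∀ d s n t → d * (suc s * suc n + (t + suc s)) ≡ d * (suc s * suc n + t) + d * suc s
    e₁ = solve-∀
    e₂ : ∀ d s n t → d * (suc s * n + (t + suc s)) ≡ d * (suc s * suc n + t)
    e₂ = solve-∀
    e₃ : ∀ d s n t → d * (suc s * suc n + t) + d * suc s + d * suc n ≡ d * (suc (suc s) * suc n + (t + suc s))
    e₃ = solve-∀

  -- At `j = 0` the product is empty: the telescoped remainder is the monomial for `pent⁻ n`, and
  -- the new top term is the one for `pent⁺ (suc n)`.
  shanks : ∀ n → shanksSum n n 0 ≡ pentSum d n f m
  shanks zero    = cong (λ e → shift₂ e f m) (ℕ.*-zeroʳ d)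
  shanks (suc n) = begin
    S₁ ℙ.+ y                ≡⟨ solve 3 (λ S₁ S₀ y → S₁ :+ y := S₀ :+ ((S₁ :+ S₀) :+ y)) refl S₁ S₀ y ⟩
    S₀ ℙ.+ ((S₁ ℙ.+ S₀) ℙ.+ y)  ≡⟨ cong₂ (λ u v → u ℙ.+ (v ℙ.+ y)) (shanks n) (shanks-telescope n n 0 (sym (ℕ.+-identityʳ n))) ⟩
    pentSum d n f m ℙ.+ (shift₂ (d * pent⁻ n) f m ℙ.+ y) ∎
    where
    open ≡-Reasoning
    open ℙ-Solver
    S₁ = shanksSum (suc n) n 1
    S₀ = shanksSum n n 0
    y  = shanksTerm (suc n) (suc n) 0

-- Euler's theorem, truncated: the terms of Shanks' sum with s ≥ 1 have order above n.
pentagonal : ∀ d f n m → m ≤ n → ∏∂ (suc d) 0 n f m ≡ pentSum (suc d) n f m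
pentagonal d f n m m≤n = trans (sym (only-first n 0 (ℕ.+-identityʳ n))) (shanks (suc d) f m n)
  where
  only-first : ∀ s j → s + j ≡ n → shanksSum (suc d) f m n s j ≡ ∏∂ (suc d) 0 n f m
  only-first zero    j refl = cong (λ e → shift₂ e (∏∂ (suc d) 0 n f) m) (ℕ.*-zeroʳ d)
  only-first (suc s) j eq   = trans
    (cong₂ ℙ._+_ (only-first s (suc j) (trans (ℕ.+-suc s j) eq)) (shift-< 0ℙ _ m<order))
    (ℙ.+-identityʳ _)
    where
    m<order : m < suc d * (suc s * n + tri (suc s))
    m<order = begin-strict
      m                                 ≤⟨ m≤n ⟩
      n                                 ≤⟨ ℕ.m≤m+n n (s * n) ⟩
      suc s * n                         <⟨ ℕ.m<m+n (suc s * n) (ℕ.≤-trans (s≤s z≤n) (ℕ.m≤n+m (suc s) (tri s))) ⟩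
      suc s * n + tri (suc s)           ≤⟨ ℕ.m≤n*m _ (suc d) ⟩
      suc d * (suc s * n + tri (suc s)) ∎
      where open ℕ.≤-Reasoning

-- Eta quotients modulo 2.

one₂ : Series₂
one₂ = odd ∘ one

-- The hypothesis `fac-∂` states, with the denominator cleared, that the k-th factor is congruent to
-- (1 + q^{ak}) / (1 + q^{bk}). Taking `a` and `b` as parameters treats the quotient and its inverse
-- together.
module EtaQuotient (fac : ℕ → Series) (a b : ℕ) .{{_ : NonZero a}} .{{_ : NonZero b}}
  (fac-∂ : ∀ k g → ∂ (b * suc k) (odd ∘ (g ⊛ fac (suc k))) ≗ ∂ (a * suc k) (odd ∘ g)) where

  ∏∂-prodTo : ∀ N → ∏∂ b 0 N (odd ∘ prodTo fac N) ≗ ∏∂ a 0 N one₂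
  ∏∂-prodTo zero    m = refl
  ∏∂-prodTo (suc N) m = begin
    ∂ (b * suc N) (∏∂ b 0 N (odd ∘ prodTo fac (suc N))) m  ≡⟨ ∂-∏∂ (b * suc N) b 0 N (odd ∘ prodTo fac (suc N)) m ⟩
    ∏∂ b 0 N (∂ (b * suc N) (odd ∘ prodTo fac (suc N))) m  ≡⟨ ∏∂-cong b 0 N (fac-∂ N (prodTo fac N)) m ⟩
    ∏∂ b 0 N (∂ (a * suc N) (odd ∘ prodTo fac N)) m        ≡⟨ ∂-∏∂ (a * suc N) b 0 N (odd ∘ prodTo fac N) m ⟨
    ∂ (a * suc N) (∏∂ b 0 N (odd ∘ prodTo fac N)) m        ≡⟨ ∂-cong (a * suc N) (∏∂-prodTo N) m ⟩
    ∂ (a * suc N) (∏∂ a 0 N one₂) m                        ∎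
    where open ≡-Reasoning

  -- Factors of index above j have numerator and denominator 1 + O(q^{j+1}), so one truncation `N`
  -- gives the exact parities of all coefficients up to N.
  prodTo-stable : ∀ j N → j ≤ N → odd (prodTo fac N j) ≡ odd (infProdCoeff fac j)
  prodTo-stable j N j≤N with r , refl ← ℕ.m≤n⇒∃[o]m+o≡n j≤N = go r
    where
    ∂-low : ∀ c .{{_ : NonZero c}} r f → ∂ (c * suc (j + r)) f j ≡ f j
    ∂-low c r f = trans (cong (f j ℙ.+_) (shift-< 0ℙ f (ℕ.≤-trans (s≤s (ℕ.m≤m+n j r)) (ℕ.m≤n*m _ c))))
                        (ℙ.+-identityʳ (f j))
    go : ∀ r → odd (prodTo fac (j + r) j) ≡ odd (infProdCoeff fac j)
    go zero    = cong (λ N → odd (prodTo fac N j)) (ℕ.+-identityʳ j)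
    go (suc r) = begin
      odd (prodTo fac (j + suc r) j)       ≡⟨ cong (λ N → odd (prodTo fac N j)) (ℕ.+-suc j r) ⟩
      odd (prodTo fac (suc (j + r)) j)     ≡⟨ ∂-low b r (odd ∘ prodTo fac (suc (j + r))) ⟨
      ∂ (b * suc (j + r)) (odd ∘ prodTo fac (suc (j + r))) j ≡⟨ fac-∂ (j + r) (prodTo fac (j + r)) j ⟩
      ∂ (a * suc (j + r)) (odd ∘ prodTo fac (j + r)) j       ≡⟨ ∂-low a r (odd ∘ prodTo fac (j + r)) ⟩
      odd (prodTo fac (j + r) j)           ≡⟨ go r ⟩
      odd (infProdCoeff fac j)             ∎
      where open ≡-Reasoning

∂-quotient : ∀ g d e →
  ∂ (4 * suc e) (odd ∘ (g ⊛ (pow (oneMinusQ (suc d)) 4 ⊛ pow (geomQ (suc e)) 4))) ≗ ∂ (4 * suc d) (odd ∘ g)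
∂-quotient g d e m = trans (sym (odd-Δ^4 (suc e) (g ⊛ (pow (oneMinusQ (suc d)) 4 ⊛ pow (geomQ (suc e)) 4)) m))
  (trans (cong odd (Δ^-quotient g d e 4 m)) (odd-Δ^4 (suc d) g m))

4*7* : ∀ k → 28 * k ≡ 4 * (7 * k)
4*7* = solve-∀

factorF-∂ : ∀ k g → ∂ (28 * suc k) (odd ∘ (g ⊛ factorF (suc k))) ≗ ∂ (4 * suc k) (odd ∘ g)
factorF-∂ k g m = trans (cong (λ e → ∂ e (odd ∘ (g ⊛ factorF (suc k))) m) (4*7* (suc k)))
                        -- `7 * suc k` computes to `suc (k + 6 * suc k)`, which determines this
                        -- argument.
                        (∂-quotient g k (k + 6 * suc k) m)

factorG-∂ : ∀ k g → ∂ (4 * suc k) (odd ∘ (g ⊛ factorG (suc k))) ≗ ∂ (28 * suc k) (odd ∘ g)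
factorG-∂ k g m = trans (∂-quotient g (k + 6 * suc k) k m)
                        (cong (λ e → ∂ e (odd ∘ g) m) (sym (4*7* (suc k))))

module F = EtaQuotient factorF 4 28 factorF-∂
module G = EtaQuotient factorG 28 4 factorG-∂

-- The product is congruent to ∏ (1 + q^{28k}) / (1 + q^{4k}), a series in q^4.
factorG-even : ∀ x → odd (infProdCoeff factorG (4 * x + 2)) ≡ 0ℙ
factorG-even x = trans (sym (G.prodTo-stable N N ℕ.≤-refl))
  (∏∂-vanish 0 0 N (decimate 4 2 (odd ∘ prodTo factorG N)) (suc x) vanishes x ℕ.≤-refl)
  where
  N = 4 * x + 2
  zeros : ∀ d s j → ∏∂ d s j (λ _ → 0ℙ) ≗ λ _ → 0ℙ
  zeros d s zero    m = refl
  zeros d s (suc j) m = trans (∂-cong (d * (s + suc j)) (zeros d s j) m)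
    (sym (shift-map (λ _ → 0ℙ) {0ℙ} (d * (s + suc j)) (λ _ → 0ℙ) m))
  decimate-one : decimate 4 2 one₂ ≗ λ _ → 0ℙ
  decimate-one i = cong one₂ (ℕ.+-comm (4 * i) 2)
  vanishes : ∀ i → i < suc x → ∏∂ 1 0 N (decimate 4 2 (odd ∘ prodTo factorG N)) i ≡ 0ℙ
  vanishes i _ = begin
    ∏∂ 1 0 N (decimate 4 2 (odd ∘ prodTo factorG N)) i ≡⟨ ∏∂-decimate {4} {2} (s≤s (s≤s (s≤s z≤n))) 1 0 N (odd ∘ prodTo factorG N) i ⟨
    ∏∂ 4 0 N (odd ∘ prodTo factorG N) (4 * i + 2)      ≡⟨ G.∏∂-prodTo N (4 * i + 2) ⟩
    ∏∂ 28 0 N one₂ (4 * i + 2)                         ≡⟨ ∏∂-decimate {4} {2} (s≤s (s≤s (s≤s z≤n))) 7 0 N one₂ i ⟩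
    ∏∂ 7 0 N (decimate 4 2 one₂) i                     ≡⟨ ∏∂-cong 7 0 N decimate-one i ⟩
    ∏∂ 7 0 N (λ _ → 0ℙ) i                              ≡⟨ zeros 7 0 N i ⟩
    0ℙ                                                 ∎
    where open ≡-Reasoning

-- The coefficients of ∏_{k ≤ N} (1 + q^k) / (1 + q^{7k}).
quotient : ℕ → Series₂
quotient N = decimate 4 0 (odd ∘ prodTo factorF N)

quotient-a7⁺ : ∀ N y → 4 * suc y ≤ N → quotient N (suc y) ≡ odd (a7⁺ (+ (3 + 4 * y)))
quotient-a7⁺ N y le = trans (cong (λ j → odd (prodTo factorF N j)) (index y))
  (F.prodTo-stable (4 + 4 * y) N (subst (_≤ N) (trans (sym (ℕ.+-identityʳ _)) (index y)) le))
  where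
  index : ∀ y → 4 * suc y + 0 ≡ 4 + 4 * y
  index = solve-∀

-- All exponents 28 k and 4 k are multiples of 4, so the relation descends to residue class 0 with
-- q^4 replaced by q.
∏∂-quotient : ∀ N → ∏∂ 7 0 N (quotient N) ≗ ∏∂ 1 0 N one₂
∏∂-quotient N x = begin
  ∏∂ 7 0 N (quotient N) x                          ≡⟨ ∏∂-decimate {4} {0} (s≤s z≤n) 7 0 N (odd ∘ prodTo factorF N) x ⟨
  ∏∂ 28 0 N (odd ∘ prodTo factorF N) (4 * x + 0)   ≡⟨ F.∏∂-prodTo N (4 * x + 0) ⟩
  ∏∂ 4 0 N one₂ (4 * x + 0)                        ≡⟨ ∏∂-decimate {4} {0} (s≤s z≤n) 1 0 N one₂ x ⟩
  ∏∂ 1 0 N (decimate 4 0 one₂) x                   ≡⟨ ∏∂-cong 1 0 N decimate-one x ⟩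
  ∏∂ 1 0 N one₂ x                                  ∎
  where
  open ≡-Reasoning
  decimate-one : decimate 4 0 one₂ ≗ one₂
  decimate-one zero    = refl
  decimate-one (suc i) = refl

-- Size and order of the pentagonal numbers.

2*tri : ∀ s → 2 * tri s ≡ s * suc s
2*tri zero    = refl
2*tri (suc s) = trans (ℕ.*-distribˡ-+ 2 (tri s) (suc s)) (trans (cong (_+ 2 * suc s) (2*tri s)) (collect s))
  where
  collect : ∀ s → s * suc s + 2 * suc s ≡ suc s * suc (suc s)
  collect = solve-∀

2*pent⁺ : ∀ s → 2 * pent⁺ s ≡ s * (3 * s + 1)
2*pent⁺ s = trans (ℕ.*-distribˡ-+ 2 (s * s) (tri s)) (trans (cong (λ k → 2 * (s * s) + k) (2*tri s)) (collect s))
  where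
  collect : ∀ s → 2 * (s * s) + s * suc s ≡ s * (3 * s + 1)
  collect = solve-∀

-- This gap is what produces the lower end of the interval in (a).
pent⁻≡pent⁺ : ∀ s → pent⁻ s ≡ pent⁺ s + (2 * s + 1)
pent⁻≡pent⁺ s = expand s (tri s)
  where
  expand : ∀ s t → suc s * suc s + t ≡ s * s + t + (2 * s + 1)
  expand = solve-∀

2*pent⁻ : ∀ s → 2 * pent⁻ s ≡ suc s * (3 * s + 2)
2*pent⁻ s = trans (cong (2 *_) (pent⁻≡pent⁺ s))
  (trans (ℕ.*-distribˡ-+ 2 (pent⁺ s) (2 * s + 1)) (trans (cong (_+ 2 * (2 * s + 1)) (2*pent⁺ s)) (collect s)))
  where
  collect : ∀ s → s * (3 * s + 1) + 2 * (2 * s + 1) ≡ suc s * (3 * s + 2)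
  collect = solve-∀

pent⁺≤pent⁻ : ∀ s → pent⁺ s ≤ pent⁻ s
pent⁺≤pent⁻ s = subst (pent⁺ s ≤_) (sym (pent⁻≡pent⁺ s)) (ℕ.m≤m+n (pent⁺ s) (2 * s + 1))

pent⁻<pent⁺ : ∀ s → pent⁻ s < pent⁺ (suc s)
pent⁻<pent⁺ s = ℕ.+-monoʳ-< (suc s * suc s) (ℕ.m<m+n (tri s) (s≤s z≤n))

pent⁻-mono-≤ : ∀ s r → pent⁻ s ≤ pent⁻ (s + r)
pent⁻-mono-≤ s zero    = ℕ.≤-reflexive (cong pent⁻ (sym (ℕ.+-identityʳ s)))
pent⁻-mono-≤ s (suc r) = subst (λ k → pent⁻ s ≤ pent⁻ k) (sym (ℕ.+-suc s r))
  (ℕ.≤-trans (pent⁻-mono-≤ s r) (ℕ.≤-trans (ℕ.<⇒≤ (pent⁻<pent⁺ (s + r))) (pent⁺≤pent⁻ (suc (s + r)))))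

-- The exponents increase in the order `pent⁻ t`, `pent⁺ (suc t)`, `pent⁻ (suc t)` and so on, so all
-- omitted terms have order above m.
pentSum-truncate : ∀ d f m t r → m < suc d * pent⁻ t → pentSum (suc d) (t + r) f m ≡ pentSum (suc d) t f m
pentSum-truncate d f m t zero    lt = cong (λ n → pentSum (suc d) n f m) (ℕ.+-identityʳ t)
pentSum-truncate d f m t (suc r) lt = begin
  pentSum (suc d) (t + suc r) f m                        ≡⟨ cong (λ n → pentSum (suc d) n f m) (ℕ.+-suc t r) ⟩
  pentSum (suc d) (suc (t + r)) f m                      ≡⟨ cong (pentSum (suc d) (t + r) f m ℙ.+_)
                                                              (cong₂ ℙ._+_ (shift-< 0ℙ f lt⁻) (shift-< 0ℙ f lt⁺)) ⟩
  pentSum (suc d) (t + r) f m ℙ.+ 0ℙ                     ≡⟨ ℙ.+-identityʳ _ ⟩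
  pentSum (suc d) (t + r) f m                            ≡⟨ pentSum-truncate d f m t r lt ⟩
  pentSum (suc d) t f m                                  ∎
  where
  open ≡-Reasoning
  lt⁻ : m < suc d * pent⁻ (t + r)
  lt⁻ = ℕ.<-≤-trans lt (ℕ.*-monoʳ-≤ (suc d) (pent⁻-mono-≤ t r))
  lt⁺ : m < suc d * pent⁺ (suc (t + r))
  lt⁺ = ℕ.<-≤-trans lt⁻ (ℕ.*-monoʳ-≤ (suc d) (ℕ.<⇒≤ (pent⁻<pent⁺ (t + r))))

pentSum-odd : ∀ d n f m → pentSum d n f m ≡ 1ℙ → ∃[ e ] (e ≤ pent⁺ n) × (shift₂ (d * e) f m ≡ 1ℙ)
pentSum-odd d zero    f m eq = 0 , z≤n , trans (cong (λ e → shift₂ e f m) (ℕ.*-zeroʳ d)) eq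
pentSum-odd d (suc n) f m eq
  with shift₂ (d * pent⁻ n) f m in eq⁻ | shift₂ (d * pent⁺ (suc n)) f m in eq⁺
... | 1ℙ | _  = pent⁻ n , ℕ.<⇒≤ (pent⁻<pent⁺ n) , eq⁻
... | 0ℙ | 1ℙ = pent⁺ (suc n) , ℕ.≤-refl , eq⁺
... | 0ℙ | 0ℙ with e , e≤ , odd-e ← pentSum-odd d n f m (trans (sym (ℙ.+-identityʳ _)) eq)
  = e , ℕ.≤-trans e≤ (ℕ.≤-trans (pent⁺≤pent⁻ n) (ℕ.<⇒≤ (pent⁻<pent⁺ n))) , odd-e

-- The recurrence at indices that are not pentagonal.

shift₂-one : ∀ e m → m ≢ e → shift₂ e one₂ m ≡ 0ℙ
shift₂-one zero    zero    m≢e = contradiction refl m≢e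
shift₂-one zero    (suc m) m≢e = refl
shift₂-one (suc e) zero    m≢e = refl
shift₂-one (suc e) (suc m) m≢e = shift₂-one e m (m≢e ∘ cong suc)

NotPentagonal : ℕ → Set
NotPentagonal m = (∀ s → m ≢ pent⁺ s) × (∀ s → m ≢ pent⁻ s)

pentSum-one : ∀ n m → NotPentagonal m → pentSum 1 n one₂ m ≡ 0ℙ
pentSum-one zero    m (≢⁺ , ≢⁻) = shift₂-one 0 m (≢⁺ 0)
pentSum-one (suc n) m (≢⁺ , ≢⁻) = cong₂ ℙ._+_ (pentSum-one n m (≢⁺ , ≢⁻))
  (cong₂ ℙ._+_ (shift₂-one _ m (λ eq → ≢⁻ n (trans eq (ℕ.*-identityˡ (pent⁻ n)))))
               (shift₂-one _ m (λ eq → ≢⁺ (suc n) (trans eq (ℕ.*-identityˡ (pent⁺ (suc n)))))))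

-- Only the numerator is expanded by Euler's theorem. The denominator stays a product, because (a)
-- expands it as well while (b) restricts it to a residue class.
quotient-recurrence : ∀ N m → m ≤ N → NotPentagonal m → ∏∂ 7 0 N (quotient N) m ≡ 0ℙ
quotient-recurrence N m m≤N ¬pent =
  trans (∏∂-quotient N m) (trans (pentagonal 0 one₂ N m m≤N) (pentSum-one N m ¬pent))

-- Parity and divisibility.

parity-divides : ∀ n → 2 ℕ.∣ n → parity n ≡ 0ℙ
parity-divides _ (ℕ.divides q refl) = trans (ℙ.*-homo-* q 2) (ℙ.*-zeroʳ (parity q))

divides-parity : ∀ n → parity n ≡ 0ℙ → 2 ℕ.∣ n
divides-parity zero          eq = 2 ℕ.∣0
divides-parity (suc (suc n)) eq = ℕ.∣m∣n⇒∣m+n ℕ.∣-refl (divides-parity n eq)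

odd⇒∤ : ∀ {z} → odd z ≡ 1ℙ → ¬ ((+ 2) ∣ z)
odd⇒∤ {z} eq 2∣z with () ← trans (sym eq) (parity-divides ∣ z ∣ 2∣z)

even⇒∣ : ∀ {z} → odd z ≡ 0ℙ → (+ 2) ∣ z
even⇒∣ {z} = divides-parity ∣ z ∣

[3+4y]%4≡3 : ∀ y → (3 + 4 * y) % 4 ≡ 3
[3+4y]%4≡3 y = trans (cong (λ k → (3 + k) % 4) (ℕ.*-comm 4 y)) ([m+kn]%n≡m%n 3 y 4)

-- Odd coefficients, with t = τ + 1.

exists-odd : ∀ τ m → m ≡ 7 * pent⁻ τ → NotPentagonal m →
  ∃[ y ] (14 * τ + 6 ≤ y) × (suc y ≤ m) × (odd (a7⁺ (+ (3 + 4 * y))) ≡ 1ℙ)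
exists-odd τ m m≡7p ¬pent =
  let e , e≤pent , odd-e = pentSum-odd 7 τ H m other-terms
  in index-suffices e odd-e (index-of e e≤pent)
  where
  -- Entry m of `quotient` is coefficient 4 m of the product.
  N = 4 * m
  H = quotient N

  τ<N : suc τ ≤ N
  τ<N = begin
    suc τ          ≤⟨ ℕ.m≤m*n (suc τ) (suc τ) ⟩
    suc τ * suc τ  ≤⟨ ℕ.m≤m+n _ (tri τ) ⟩
    pent⁻ τ        ≤⟨ ℕ.m≤n*m _ 7 ⟩
    7 * pent⁻ τ    ≡⟨ m≡7p ⟨
    m              ≤⟨ ℕ.m≤n*m m 4 ⟩
    N              ∎
    where open ℕ.≤-Reasoning

  -- The next pair of exponents already exceeds m, so the sum may stop at index τ + 1.
  next : m < 7 * pent⁻ (suc τ)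
  next = subst (_< 7 * pent⁻ (suc τ)) (sym m≡7p) (ℕ.*-monoʳ-< 7 (ℕ.<-≤-trans (pent⁻<pent⁺ τ) (pent⁺≤pent⁻ (suc τ))))

  sum-τ+1 : pentSum 7 (suc τ) H m ≡ 0ℙ
  sum-τ+1 with r , eq ← ℕ.m≤n⇒∃[o]m+o≡n τ<N = begin
    pentSum 7 (suc τ) H m        ≡⟨ pentSum-truncate 6 H m (suc τ) r next ⟨
    pentSum 7 (suc τ + r) H m    ≡⟨ cong (λ n → pentSum 7 n H m) eq ⟩
    pentSum 7 N H m              ≡⟨ pentagonal 6 H N m (ℕ.m≤n*m m 4) ⟨
    ∏∂ 7 0 N H m                 ≡⟨ quotient-recurrence N m (ℕ.m≤n*m m 4) ¬pent ⟩
    0ℙ                           ∎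
    where open ≡-Reasoning

  constant-term : shift₂ (7 * pent⁻ τ) H m ≡ 1ℙ
  constant-term = begin
    shift₂ (7 * pent⁻ τ) H m   ≡⟨ cong (λ e → shift₂ e H m) m≡7p ⟨
    shift₂ m H m               ≡⟨ cong₂ (λ e k → shift₂ e H k) (ℕ.+-identityʳ m) (ℕ.+-identityʳ m) ⟨
    shift₂ (m + 0) H (m + 0)   ≡⟨ shift-+ 0ℙ m 0 H 0 ⟩
    H 0                        ≡⟨ F.prodTo-stable 0 N z≤n ⟩
    1ℙ                         ∎
    where open ≡-Reasoning

  -- In the pair that contains h(0), the second exponent exceeds m; the pair contributes exactly 1,
  -- which the earlier terms must cancel.
  last-terms : shift₂ (7 * pent⁻ τ) H m ℙ.+ shift₂ (7 * pent⁺ (suc τ)) H m ≡ 1ℙ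
  last-terms = cong₂ ℙ._+_ constant-term
    (shift-< 0ℙ H (subst (_< 7 * pent⁺ (suc τ)) (sym m≡7p) (ℕ.*-monoʳ-< 7 (pent⁻<pent⁺ τ))))

  other-terms : pentSum 7 τ H m ≡ 1ℙ
  other-terms = ℙ.+-cancelʳ-≡ 1ℙ _ _ (trans (cong (pentSum 7 τ H m ℙ.+_) (sym last-terms)) sum-τ+1)

  -- The earlier exponents satisfy e ≤ `pent⁺ τ`, so m - 7 e is at least 7 (2 τ + 1) = 14 τ + 7, the
  -- successor of the bound on y.
  index-of : ∀ e → e ≤ pent⁺ τ → ∃[ y ] (14 * τ + 6 ≤ y) × (7 * e + suc y ≡ m)
  index-of e e≤pent = let o , eq = ℕ.m≤n⇒∃[o]m+o≡n gap in
    14 * τ + 6 + o , ℕ.m≤m+n (14 * τ + 6) o , trans (sym (ℕ.+-assoc (7 * e) (suc (14 * τ + 6)) o)) eq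
    where
    expand : ∀ p t → 7 * p + suc (14 * t + 6) ≡ 7 * (p + (2 * t + 1))
    expand = solve-∀
    gap : 7 * e + suc (14 * τ + 6) ≤ m
    gap = begin
      7 * e + suc (14 * τ + 6)        ≤⟨ ℕ.+-monoˡ-≤ _ (ℕ.*-monoʳ-≤ 7 e≤pent) ⟩
      7 * pent⁺ τ + suc (14 * τ + 6)  ≡⟨ expand (pent⁺ τ) τ ⟩
      7 * (pent⁺ τ + (2 * τ + 1))     ≡⟨ cong (7 *_) (pent⁻≡pent⁺ τ) ⟨
      7 * pent⁻ τ                     ≡⟨ m≡7p ⟨
      m                               ∎
      where open ℕ.≤-Reasoning

  odd-index : ∀ e y → 7 * e + suc y ≡ m → shift₂ (7 * e) H m ≡ 1ℙ → H (suc y) ≡ 1ℙ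
  odd-index e y eq odd-e = begin
    H (suc y)                              ≡⟨ shift-+ 0ℙ (7 * e) 0 H (suc y) ⟨
    shift₂ (7 * e + 0) H (7 * e + suc y)   ≡⟨ cong₂ (λ k i → shift₂ k H i) (ℕ.+-identityʳ (7 * e)) eq ⟩
    shift₂ (7 * e) H m                     ≡⟨ odd-e ⟩
    1ℙ                                     ∎
    where open ≡-Reasoning

  index-suffices : ∀ e → shift₂ (7 * e) H m ≡ 1ℙ → ∃[ y ] (14 * τ + 6 ≤ y) × (7 * e + suc y ≡ m) →
    ∃[ y ] (14 * τ + 6 ≤ y) × (suc y ≤ m) × (odd (a7⁺ (+ (3 + 4 * y))) ≡ 1ℙ)
  index-suffices e odd-e (y , y≥ , eq) =
    y , y≥ , y<m , trans (sym (quotient-a7⁺ N y (ℕ.*-monoʳ-≤ 4 y<m))) (odd-index e y eq odd-e)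
    where
    y<m : suc y ≤ m
    y<m = subst (suc y ≤_) eq (ℕ.m≤n+m (suc y) (7 * e))

-- Residues of pentagonal numbers and even coefficients.

residues : ∀ p .{{_ : NonZero p}} a b r → (∀ {i} → i < p → (a + i) * (3 * i + b) % p ≢ r) →
  ∀ s → (a + s) * (3 * s + b) % p ≢ r
residues p a b r avoid s eq = avoid (m%n<n s p) (trans (sym reduce) eq)
  where
  i = s % p
  q = s / p
  expand : ∀ a b p i q → (a + (i + q * p)) * (3 * (i + q * p) + b)
    ≡ (a + i) * (3 * i + b) + (3 * q * (a + i) + q * (3 * i + b) + 3 * q * (q * p)) * p
  expand = solve-∀
  reduce : (a + s) * (3 * s + b) % p ≡ (a + i) * (3 * i + b) % p
  reduce = trans (cong (λ k → (a + k) * (3 * k + b) % p) (m≡m%n+[m/n]*n s p))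
    (trans (cong (_% p) (expand a b p i q)) ([m+kn]%n≡m%n ((a + i) * (3 * i + b)) (3 * q * (a + i) + q * (3 * i + b) + 3 * q * (q * p)) p))

-- For (a, b) = (0, 1) and (1, 2) the quadratic is twice `pent⁺` and twice `pent⁻`. A search over
-- one period decides whether they miss r, and `from-yes` runs it.
avoids? : ∀ p .{{_ : NonZero p}} a b r → _
avoids? p a b r = ℕ.allUpTo? (λ i → ¬? ((a + i) * (3 * i + b) % p ℕ.≟ r)) p

-- Modulo 7, l (3 l ± 1) takes only the values 0, 2, 3 and 4, whereas 2 (7 x + 3) is 6.
¬pentagonal-3-mod-7 : ∀ x → NotPentagonal (7 * x + 3)
¬pentagonal-3-mod-7 x =
  (λ s eq → residues 7 0 1 6 (from-yes (avoids? 7 0 1 6)) s (residue-6 (trans (cong (2 *_) eq) (2*pent⁺ s)))) ,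
  (λ s eq → residues 7 1 2 6 (from-yes (avoids? 7 1 2 6)) s (residue-6 (trans (cong (2 *_) eq) (2*pent⁻ s))))
  where
  expand : ∀ x → 2 * (7 * x + 3) ≡ 6 + 2 * x * 7
  expand = solve-∀
  residue-6 : ∀ {k} → 2 * (7 * x + 3) ≡ k → k % 7 ≡ 6
  residue-6 refl = trans (cong (_% 7) (expand x)) ([m+kn]%n≡m%n 6 (2 * x) 7)

-- The factors 1 + q^{7k} preserve residue classes modulo 7. On the class of 3 the right-hand side
-- vanishes, and dividing by the invertible product kills h there. The index 7 x + 3 corresponds to
-- n = 28 x + 11.
a7⁺-even : ∀ x → odd (a7⁺ (+ (3 + 4 * (7 * x + 2)))) ≡ 0ℙ
a7⁺-even x = trans (sym (quotient-a7⁺ N (7 * x + 2) (ℕ.≤-reflexive (cong (4 *_) (sym (ℕ.+-suc (7 * x) 2))))))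
  (trans (cong H (sym (ℕ.+-suc (7 * x) 2))) (∏∂-vanish 0 0 N (decimate 7 3 H) (suc x) vanishes x ℕ.≤-refl))
  where
  N = 4 * (7 * x + 3)
  H = quotient N
  vanishes : ∀ i → i < suc x → ∏∂ 1 0 N (decimate 7 3 H) i ≡ 0ℙ
  vanishes i (s≤s i≤x) = trans
    (sym (∏∂-decimate {7} {3} (s≤s (s≤s (s≤s (s≤s z≤n)))) 1 0 N H i))
    (quotient-recurrence N (7 * i + 3)
      (ℕ.≤-trans (ℕ.+-monoˡ-≤ 3 (ℕ.*-monoʳ-≤ 7 i≤x)) (ℕ.m≤n*m (7 * x + 3) 4))
      (¬pentagonal-3-mod-7 i))

-- For n = 4 y + 3 the constant 4 does not contribute, and `b7⁺` takes the coefficient n - 1 = 4 y +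
-- 2 of its product, which is even.
odd-c7⁺ : ∀ y → odd (c7⁺ (+ (3 + 4 * y))) ≡ odd (a7⁺ (+ (3 + 4 * y)))
odd-c7⁺ y = begin
  odd (c7⁺ n)                               ≡⟨ odd-+ (a7⁺ n ℤ.+ + 0) (+ 49 ℤ.* b7⁺ n) ⟩
  odd (a7⁺ n ℤ.+ + 0) ℙ.+ odd (+ 49 ℤ.* b7⁺ n) ≡⟨ cong₂ ℙ._+_ (cong odd (ℤ.+-identityʳ (a7⁺ n))) even-b ⟩
  odd (a7⁺ n) ℙ.+ 0ℙ                        ≡⟨ ℙ.+-identityʳ _ ⟩
  odd (a7⁺ n)                               ∎
  where
  open ≡-Reasoning
  n = + (3 + 4 * y)
  even-b : odd (+ 49 ℤ.* b7⁺ n) ≡ 0ℙ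
  even-b = begin
    odd (+ 49 ℤ.* b7⁺ n)       ≡⟨ cong parity (ℤ.abs-* (+ 49) (b7⁺ n)) ⟩
    parity (49 * ∣ b7⁺ n ∣)    ≡⟨ ℙ.*-homo-* 49 ∣ b7⁺ n ∣ ⟩
    odd (b7⁺ n)                ≡⟨ cong (odd ∘ infProdCoeff factorG) (ℕ.+-comm 2 (4 * y)) ⟩
    odd (infProdCoeff factorG (4 * y + 2)) ≡⟨ factorG-even y ⟩
    0ℙ                         ∎

-- Translation to the stated intervals.

3*suc∸1 : ∀ s → 3 * suc s ∸ 1 ≡ 3 * s + 2
3*suc∸1 s = cong (_∸ 1) (expand s)
  where
  expand : ∀ s → 3 * suc s ≡ suc (3 * s + 2)
  expand = solve-∀

2*7* : ∀ p → 2 * (7 * p) ≡ 7 * (2 * p)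
2*7* = solve-∀

2*7pent⁻ : ∀ τ → 2 * (7 * pent⁻ τ) ≡ 7 * suc τ * (3 * suc τ ∸ 1)
2*7pent⁻ τ = begin
  2 * (7 * pent⁻ τ)             ≡⟨ 2*7* (pent⁻ τ) ⟩
  7 * (2 * pent⁻ τ)             ≡⟨ cong (7 *_) (2*pent⁻ τ) ⟩
  7 * (suc τ * (3 * τ + 2))     ≡⟨ ℕ.*-assoc 7 (suc τ) (3 * τ + 2) ⟨
  7 * suc τ * (3 * τ + 2)       ≡⟨ cong (7 * suc τ *_) (3*suc∸1 τ) ⟨
  7 * suc τ * (3 * suc τ ∸ 1)   ∎
  where
  open ≡-Reasoning

¬pentagonal-7pent⁻ : ∀ τ →
  (∀ l → (7 * suc τ * (3 * suc τ ∸ 1) ≢ l * (3 * l ∸ 1)) × (7 * suc τ * (3 * suc τ ∸ 1) ≢ l * (3 * l + 1))) →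
  NotPentagonal (7 * pent⁻ τ)
¬pentagonal-7pent⁻ τ avoid =
  (λ s eq → proj₂ (avoid s) (trans (sym (2*7pent⁻ τ)) (trans (cong (2 *_) eq) (2*pent⁺ s)))) ,
  -- `pent⁻ s` has its index off by one, so it corresponds to l = s + 1.
  (λ s eq → proj₁ (avoid (suc s)) (trans (sym (2*7pent⁻ τ)) (trans (cong (2 *_) eq)
    (trans (2*pent⁻ s) (cong (suc s *_) (sym (3*suc∸1 s)))))))

-- From y ≥ 14 τ + 6 one gets 4 y + 3 ≥ 56 τ + 27 = 56 t - 29, and from y + 1 ≤ 7 `pent⁻ τ` one gets
-- 4 (y + 1) ≤ 14 t (3 t - 1).
odd-in-interval : ∀ τ → NotPentagonal (7 * pent⁻ τ) →
  ∃[ y ] (56 * suc τ ∸ 29 ≤ 3 + 4 * y) × (3 + 4 * y ≤ 14 * suc τ * (3 * suc τ ∸ 1) ∸ 1) × (odd (a7⁺ (+ (3 + 4 * y))) ≡ 1ℙ)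
odd-in-interval τ ¬pent = bounds (exists-odd τ (7 * pent⁻ τ) refl ¬pent)
  where
  bounds : ∃[ y ] (14 * τ + 6 ≤ y) × (suc y ≤ 7 * pent⁻ τ) × (odd (a7⁺ (+ (3 + 4 * y))) ≡ 1ℙ) →
    ∃[ y ] (56 * suc τ ∸ 29 ≤ 3 + 4 * y) × (3 + 4 * y ≤ 14 * suc τ * (3 * suc τ ∸ 1) ∸ 1) × (odd (a7⁺ (+ (3 + 4 * y))) ≡ 1ℙ)
  bounds (y , y≥ , y< , odd-y) = y , lower , upper , odd-y
    where
    open ℕ.≤-Reasoning
    e₁ : ∀ t → 56 * suc t ≡ 4 * (14 * t + 6) + 32
    e₁ = solve-∀
    e₂ : ∀ y → 4 * y + 32 ≡ 29 + (3 + 4 * y)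
    e₂ = solve-∀
    e₃ : ∀ y → suc (3 + 4 * y) ≡ 4 * suc y
    e₃ = solve-∀
    e₄ : ∀ p → 4 * p ≡ 2 * (2 * p)
    e₄ = solve-∀
    e₅ : ∀ s x → 2 * (7 * s * x) ≡ 14 * s * x
    e₅ = solve-∀
    lower : 56 * suc τ ∸ 29 ≤ 3 + 4 * y
    lower = ℕ.m≤n+o⇒m∸n≤o (56 * suc τ) 29 (begin
      56 * suc τ             ≡⟨ e₁ τ ⟩
      4 * (14 * τ + 6) + 32  ≤⟨ ℕ.+-monoˡ-≤ 32 (ℕ.*-monoʳ-≤ 4 y≥) ⟩
      4 * y + 32             ≡⟨ e₂ y ⟩
      29 + (3 + 4 * y)       ∎)
    upper : 3 + 4 * y ≤ 14 * suc τ * (3 * suc τ ∸ 1) ∸ 1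
    upper = ℕ.∸-monoˡ-≤ 1 (begin
      suc (3 + 4 * y)                     ≡⟨ e₃ y ⟩
      4 * suc y                           ≤⟨ ℕ.*-monoʳ-≤ 4 y< ⟩
      4 * (7 * pent⁻ τ)                   ≡⟨ e₄ (7 * pent⁻ τ) ⟩
      2 * (2 * (7 * pent⁻ τ))             ≡⟨ cong (2 *_) (2*7pent⁻ τ) ⟩
      2 * (7 * suc τ * (3 * suc τ ∸ 1))   ≡⟨ e₅ (suc τ) (3 * suc τ ∸ 1) ⟩
      14 * suc τ * (3 * suc τ ∸ 1)        ∎)

-- The witness is 28 x + 11 at x = 4 τ + 3, that is 112 t - 17, which lies 12 above the lower end.
even-in-interval : ∀ τ → let n = 3 + 4 * (7 * (4 * τ + 3) + 2) in
  (112 * suc τ ∸ 29 ≤ n) × (n ≤ 28 * suc τ * (6 * suc τ ∸ 1) ∸ 1)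
even-in-interval τ = lower , upper
  where
  open ℕ.≤-Reasoning
  e₁ : ∀ t → 29 + (3 + 4 * (7 * (4 * t + 3) + 2)) ≡ 112 * suc t + 12
  e₁ = solve-∀
  -- The added polynomial is the exact distance to the upper end.
  e₂ : ∀ t → suc (3 + 4 * (7 * (4 * t + 3) + 2)) + (168 * t * t + 196 * t + 44) ≡ 28 * suc t * (6 * t + 5)
  e₂ = solve-∀
  e₃ : ∀ t → 6 * suc t ≡ suc (6 * t + 5)
  e₃ = solve-∀
  lower : 112 * suc τ ∸ 29 ≤ 3 + 4 * (7 * (4 * τ + 3) + 2)
  lower = ℕ.m≤n+o⇒m∸n≤o (112 * suc τ) 29
    (ℕ.≤-trans (ℕ.m≤m+n (112 * suc τ) 12) (ℕ.≤-reflexive (sym (e₁ τ))))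
  upper : 3 + 4 * (7 * (4 * τ + 3) + 2) ≤ 28 * suc τ * (6 * suc τ ∸ 1) ∸ 1
  upper = ℕ.∸-monoˡ-≤ 1 (begin
    suc (3 + 4 * (7 * (4 * τ + 3) + 2))  ≤⟨ ℕ.m≤m+n _ (168 * τ * τ + 196 * τ + 44) ⟩
    suc (3 + 4 * (7 * (4 * τ + 3) + 2)) + (168 * τ * τ + 196 * τ + 44) ≡⟨ e₂ τ ⟩
    28 * suc τ * (6 * τ + 5)             ≡⟨ cong (λ k → 28 * suc τ * (k ∸ 1)) (e₃ τ) ⟨
    28 * suc τ * (6 * suc τ ∸ 1)         ∎)

-- For t = 5 N + 3, 7 t (3 t − 1) is 3 modulo 5, whereas l (3 l ∓ 1) is 0, 2 or 4.
¬pentagonal-mod-5 : ∀ N → NotPentagonal (7 * pent⁻ (5 * N + 2))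
¬pentagonal-mod-5 N =
  (λ s eq → residues 5 0 1 3 (from-yes (avoids? 5 0 1 3)) s (residue-3 (trans (cong (2 *_) eq) (2*pent⁺ s)))) ,
  (λ s eq → residues 5 1 2 3 (from-yes (avoids? 5 1 2 3)) s (residue-3 (trans (cong (2 *_) eq) (2*pent⁻ s))))
  where
  expand : ∀ N → 7 * (suc (5 * N + 2) * (3 * (5 * N + 2) + 2)) ≡ 3 + (105 * N * N + 119 * N + 33) * 5
  expand = solve-∀
  residue-3 : ∀ {k} → 2 * (7 * pent⁻ (5 * N + 2)) ≡ k → k % 5 ≡ 3
  residue-3 refl = trans (cong (_% 5) (trans (2*7* (pent⁻ (5 * N + 2)))
    (trans (cong (7 *_) (2*pent⁻ (5 * N + 2))) (expand N)))) ([m+kn]%n≡m%n 3 (105 * N * N + 119 * N + 33) 5)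

-- Parities of `a7⁺` in the intervals and of `c7⁺` beyond any bound.

interval-odd : ∀ {lo hi} → ∃[ y ] (lo ≤ 3 + 4 * y) × (3 + 4 * y ≤ hi) × (odd (a7⁺ (+ (3 + 4 * y))) ≡ 1ℙ) →
  ∃[ n ] (lo ≤ n) × (n ≤ hi) × (n % 4 ≡ 3) × ¬ ((+ 2) ∣ a7⁺ (+ n))
interval-odd (y , lo≤ , ≤hi , odd-y) =
  3 + 4 * y , lo≤ , ≤hi , [3+4y]%4≡3 y , odd⇒∤ {a7⁺ (+ (3 + 4 * y))} odd-y

interval-even : ∀ {lo hi} y → (lo ≤ 3 + 4 * y) × (3 + 4 * y ≤ hi) → odd (a7⁺ (+ (3 + 4 * y))) ≡ 0ℙ →
  ∃[ n ] (lo ≤ n) × (n ≤ hi) × (n % 4 ≡ 3) × ((+ 2) ∣ a7⁺ (+ n))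
interval-even y (lo≤ , ≤hi) even-y =
  3 + 4 * y , lo≤ , ≤hi , [3+4y]%4≡3 y , even⇒∣ {a7⁺ (+ (3 + 4 * y))} even-y

c7⁺-odd-beyond : ∀ N → ∃[ y ] (14 * (5 * N + 2) + 6 ≤ y) × (suc y ≤ 7 * pent⁻ (5 * N + 2)) × (odd (a7⁺ (+ (3 + 4 * y))) ≡ 1ℙ) →
  ∃[ n ] (N ≤ n) × (n % 4 ≡ 3) × ¬ ((+ 2) ∣ c7⁺ (+ n))
c7⁺-odd-beyond N (y , y≥ , _ , odd-y) =
  3 + 4 * y , N≤ , [3+4y]%4≡3 y , odd⇒∤ {c7⁺ (+ (3 + 4 * y))} (trans (odd-c7⁺ y) odd-y)
  where
  N≤ : N ≤ 3 + 4 * y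
  N≤ = begin
    N                       ≤⟨ ℕ.m≤n*m N 5 ⟩
    5 * N                   ≤⟨ ℕ.m≤m+n (5 * N) 2 ⟩
    5 * N + 2               ≤⟨ ℕ.m≤n*m (5 * N + 2) 14 ⟩
    14 * (5 * N + 2)        ≤⟨ ℕ.m≤m+n _ 6 ⟩
    14 * (5 * N + 2) + 6    ≤⟨ y≥ ⟩
    y                       ≤⟨ ℕ.m≤n*m y 4 ⟩
    4 * y                   ≤⟨ ℕ.m≤n+m (4 * y) 3 ⟩
    3 + 4 * y               ∎
    where open ℕ.≤-Reasoning

c7⁺-even-beyond : ∀ N y → 7 * N + 2 ≤ y → odd (a7⁺ (+ (3 + 4 * y))) ≡ 0ℙ →
  ∃[ n ] (N ≤ n) × (n % 4 ≡ 3) × ((+ 2) ∣ c7⁺ (+ n))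
c7⁺-even-beyond N y y≥ even-y =
  3 + 4 * y , N≤ , [3+4y]%4≡3 y , even⇒∣ {c7⁺ (+ (3 + 4 * y))} (trans (odd-c7⁺ y) even-y)
  where
  N≤ : N ≤ 3 + 4 * y
  N≤ = begin
    N                       ≤⟨ ℕ.m≤n*m N 7 ⟩
    7 * N                   ≤⟨ ℕ.m≤m+n (7 * N) 2 ⟩
    7 * N + 2               ≤⟨ y≥ ⟩
    y                       ≤⟨ ℕ.m≤n*m y 4 ⟩
    4 * y                   ≤⟨ ℕ.m≤n+m _ 3 ⟩
    3 + 4 * y               ∎
    where open ℕ.≤-Reasoning

theorem4p1 : ((t : ℕ) → 1 ≤ t
    → (∀ (l : ℕ) → (7 * t * (3 * t ∸ 1) ≢ l * (3 * l ∸ 1)) × (7 * t * (3 * t ∸ 1) ≢ l * (3 * l + 1)))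
    → ∃[ n ] ((56 * t ∸ 29 ≤ n) × (n ≤ 14 * t * (3 * t ∸ 1) ∸ 1) × (n % 4 ≡ 3) × ¬ ((+ 2) ∣ a7⁺ (+ n))))
    × ((t : ℕ) → 1 ≤ t
    → (∀ (l : ℕ) → (14 * t * (6 * t ∸ 1) ≢ l * (3 * l ∸ 1)) × (14 * t * (6 * t ∸ 1) ≢ l * (3 * l + 1)))
    → ∃[ n ] ((112 * t ∸ 29 ≤ n) × (n ≤ 28 * t * (6 * t ∸ 1) ∸ 1) × (n % 4 ≡ 3) × ((+ 2) ∣ a7⁺ (+ n))))
    × ((N : ℕ) → ∃[ n ] ((N ≤ n) × (n % 4 ≡ 3) × ¬ ((+ 2) ∣ c7⁺ (+ n))))
    × ((N : ℕ) → ∃[ n ] ((N ≤ n) × (n % 4 ≡ 3) × ((+ 2) ∣ c7⁺ (+ n))))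
theorem4p1 =
    (λ { (suc τ) _ avoid → interval-odd (odd-in-interval τ (¬pentagonal-7pent⁻ τ avoid)) })
  , (λ { (suc τ) _ _ → interval-even (7 * (4 * τ + 3) + 2) (even-in-interval τ) (a7⁺-even (4 * τ + 3)) })
  , (λ N → c7⁺-odd-beyond N (exists-odd (5 * N + 2) (7 * pent⁻ (5 * N + 2)) refl (¬pentagonal-mod-5 N)))
  , (λ N → c7⁺-even-beyond N (7 * N + 2) ℕ.≤-refl (a7⁺-even N))
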